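{- For every integer $n\ge 0$, $$C_{n+1}C_{n+2}=\sum_{k=0}^{n}\frac{(2k+2)(2k+3)(2k+4)}{(2n+2)(2n+3)(2n+6)(2n+7)}\binom{2n+3}{n-k}\binom{2n+7}{n-k+2}.$$
   Context: $C_n=\frac{1}{n+1}\binom{2n}{n}$ is the $n$-th Catalan number. -}

module Defs where

open import Data.Integer using (+_)
open import Data.Nat using (ℕ; suc; _+_; _*_; _∸_)
open import Data.Nat.Combinatorics using (_C_)
open import Data.Rational as ℚ using (ℚ; _/_)
open import Data.Rational.Properties using (+-0-monoid)

-- ∑[ k ≤ n ] f k is the rational sum over k : Fin (suc n), i.e. k = 0, …, n.
open import Algebra.Properties.Monoid.Sum +-0-monoid public
  using (sum⁺-syntax)

fromℕ : ℕ → ℚ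
fromℕ n = + n / 1

catalan : ℕ → ℚ
catalan n = (+ 1 / suc n) ℚ.* fromℕ ((2 * n) C n)

-- In the denominator the constants come first (2 + 2 * n, not 2 * n + 2) so that
-- it reduces to a successor and its NonZero instance is found by computation.
-- In the binomials n ∸ k is a genuine subtraction for k ≤ n, the only case used.
summand : ℕ → ℕ → ℚ
summand n k =
  (+ ((2 * k + 2) * (2 * k + 3) * (2 * k + 4))
    / ((2 + 2 * n) * (3 + 2 * n) * (6 + 2 * n) * (7 + 2 * n)))
  ℚ.* fromℕ ((2 * n + 3) C (n ∸ k))
  ℚ.* fromℕ ((2 * n + 7) C (n ∸ k + 2))

{-# OPTIONS --safe #-}
module Submission where

-- With x = k + 3/2 the summand is, up to a constant depending on n,
-- x(4x² - 1) C(2a, a - x) C(2b, b - x) for a = n + 3/2 and b = n + 7/2.  The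
-- weight is odd in x, so Gosper's algorithm sums it with a certificate that is
-- even in x - 1/2 = k + 1, here (n + 1)(n + 3) + (2n + 5)(k + 1)².  The full sum
-- is thus a single product C(2n+3, n) C(2n+7, n+2) times a rational function of
-- n, and both binomials reduce to central ones.

open import Defs
open import Data.Nat using (ℕ; _+_)
open import Data.Fin using (toℕ)
open import Data.Rational as ℚ using (ℚ)
open import Relation.Binary.PropositionalEquality using (_≡_)

open import Algebra.Bundles using (CommutativeMonoid)
import Algebra.Properties.CommutativeSemigroup as CommSemigroup
open import Data.Fin using (Fin)
open import Data.Integer as ℤ using (+_)
import Data.Integer.Properties as ℤ
open import Data.Nat using (zero; suc; _*_; _∸_; _!; NonZero)
open import Data.Nat.Combinatorics using (_C_; nCk≡n!/k![n-k]!; k![n∸k]!∣n!)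
open import Data.Nat.DivMod using (m/n*n≡m)
open import Data.Nat.Properties
  using (m≤m+n; m+n∸m≡n; +-suc; +-comm; +-identityʳ; *-assoc; *-cancelʳ-≡; _!≢0; _!*_!≢0)
open import Data.Nat.Tactic.RingSolver using (solve-∀)
open import Data.Rational.Unnormalised as ℚᵘ using (mkℚᵘ; *≡*)
import Data.Rational.Properties as ℚ
import Data.Rational.Unnormalised.Properties as ℚᵘ
open import Algebra.Properties.Monoid.Sum ℚ.+-0-monoid using (sum-cong-≗)
open import Relation.Binary.PropositionalEquality
  using (refl; sym; trans; cong; cong₂; subst; module ≡-Reasoning)

open ≡-Reasoning
open CommSemigroup (CommutativeMonoid.commutativeSemigroup ℚ.*-1-commutativeMonoid)
  using (interchange; x∙yz≈y∙xz)

-- Natural numbers inside the rationals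

-- Normalised fractions do not compute on open terms because of the gcd. In the unnormalised
-- rationals an equation is a cross-multiplication of integers, so the homomorphism laws below are
-- proved there.
toℚᵘ-/ : ∀ i d → ℚ.toℚᵘ (i ℚ./ suc d) ℚᵘ.≃ mkℚᵘ i d
toℚᵘ-/ i d = ℚ.toℚᵘ-fromℚᵘ (mkℚᵘ i d)

fromℕ-+ : ∀ a b → fromℕ (a + b) ≡ fromℕ a ℚ.+ fromℕ b
fromℕ-+ a b = ℚ.toℚᵘ-injective (ℚᵘ.≃-trans (toℚᵘ-/ (+ (a + b)) 0) (ℚᵘ.≃-sym
  (ℚᵘ.≃-trans (ℚ.toℚᵘ-homo-+ (fromℕ a) (fromℕ b))
  (ℚᵘ.≃-trans (ℚᵘ.+-cong (toℚᵘ-/ (+ a) 0) (toℚᵘ-/ (+ b) 0))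
  (*≡* (cong (ℤ._* ℤ.1ℤ)
    (cong₂ ℤ._+_ (ℤ.*-identityʳ (+ a)) (ℤ.*-identityʳ (+ b)))))))))

fromℕ-* : ∀ a b → fromℕ (a * b) ≡ fromℕ a ℚ.* fromℕ b
fromℕ-* a b = ℚ.toℚᵘ-injective (ℚᵘ.≃-trans (toℚᵘ-/ (+ (a * b)) 0) (ℚᵘ.≃-sym
  (ℚᵘ.≃-trans (ℚ.toℚᵘ-homo-* (fromℕ a) (fromℕ b))
  (ℚᵘ.≃-trans (ℚᵘ.*-cong (toℚᵘ-/ (+ a) 0) (toℚᵘ-/ (+ b) 0))
  (*≡* (cong (ℤ._* ℤ.1ℤ) (sym (ℤ.pos-* a b))))))))

fromℕ-*-/ : ∀ d a .{{_ : NonZero d}} → fromℕ d ℚ.* (+ a ℚ./ d) ≡ fromℕ a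
fromℕ-*-/ (suc d) a = ℚ.toℚᵘ-injective
  (ℚᵘ.≃-trans (ℚ.toℚᵘ-homo-* (fromℕ (suc d)) (+ a ℚ./ suc d))
  (ℚᵘ.≃-trans (ℚᵘ.*-cong (toℚᵘ-/ (+ suc d) 0) (toℚᵘ-/ (+ a) d))
  (ℚᵘ.≃-trans (*≡* numerators) (ℚᵘ.≃-sym (toℚᵘ-/ (+ a) 0)))))
  where
  numerators : (+ suc d ℤ.* + a) ℤ.* ℤ.1ℤ ≡ + a ℤ.* + (1 * suc d)
  numerators = begin
    (+ suc d ℤ.* + a) ℤ.* ℤ.1ℤ ≡⟨ ℤ.*-identityʳ _ ⟩
    + suc d ℤ.* + a            ≡⟨ ℤ.*-comm (+ suc d) (+ a) ⟩
    + a ℤ.* + suc d            ≡⟨ cong (λ m → + a ℤ.* + m) (sym (+-comm (suc d) 0)) ⟩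
    + a ℤ.* + (1 * suc d)      ∎

fromℕ-*-cancelˡ : ∀ d .{{_ : NonZero d}} {p q} → fromℕ d ℚ.* p ≡ fromℕ d ℚ.* q → p ≡ q
fromℕ-*-cancelˡ d {p} {q} eq = trans (sym (undo p)) (trans (cong (+ 1 ℚ./ d ℚ.*_) eq) (undo q))
  where
  undo : ∀ r → + 1 ℚ./ d ℚ.* (fromℕ d ℚ.* r) ≡ r
  undo r = begin
    + 1 ℚ./ d ℚ.* (fromℕ d ℚ.* r) ≡⟨ ℚ.*-assoc (+ 1 ℚ./ d) (fromℕ d) r ⟨
    + 1 ℚ./ d ℚ.* fromℕ d ℚ.* r   ≡⟨ cong (ℚ._* r) (ℚ.*-comm (+ 1 ℚ./ d) (fromℕ d)) ⟩
    fromℕ d ℚ.* (+ 1 ℚ./ d) ℚ.* r ≡⟨ cong (ℚ._* r) (fromℕ-*-/ d 1) ⟩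
    ℚ.1ℚ ℚ.* r                    ≡⟨ ℚ.*-identityˡ r ⟩
    r                             ∎

-- Division-free recurrences for binomial coefficients

C-! : ∀ a b → ((a + b) C a) * (a ! * b !) ≡ (a + b) !
C-! a b = subst (λ c → ((a + b) C a) * (a ! * c !) ≡ (a + b) !) (m+n∸m≡n a b)
  (trans (cong (_* (a ! * (a + b ∸ a) !)) (nCk≡n!/k![n-k]! (m≤m+n a b)))
         (m/n*n≡m {{a !* (a + b ∸ a) !≢0}} (k![n∸k]!∣n! (m≤m+n a b))))

-- Multiplied by `a ! * b !`, both sides become `m !`. The indices enter through equations, so that
-- upper indices such as `2 * n + 7` fit without rewriting the goal.
C-raise-upper : ∀ a b {m n} → m ≡ suc n → n ≡ a + b → suc b * (m C a) ≡ m * (n C a)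
C-raise-upper a b refl refl = *-cancelʳ-≡ _ _ (a ! * b !) {{a !* b !≢0}} (begin
  suc b * (suc (a + b) C a) * (a ! * b !)  ≡⟨ regroup (suc b) (suc (a + b) C a) (a !) (b !) ⟩
  (suc (a + b) C a) * (a ! * suc b !)      ≡⟨ cong (λ m → (m C a) * (a ! * suc b !)) (sym (+-suc a b)) ⟩
  ((a + suc b) C a) * (a ! * suc b !)      ≡⟨ C-! a (suc b) ⟩
  (a + suc b) !                            ≡⟨ cong _! (+-suc a b) ⟩
  suc (a + b) * (a + b) !                  ≡⟨ cong (suc (a + b) *_) (C-! a b) ⟨
  suc (a + b) * (((a + b) C a) * (a ! * b !)) ≡⟨ *-assoc (suc (a + b)) ((a + b) C a) (a ! * b !) ⟨
  suc (a + b) * ((a + b) C a) * (a ! * b !) ∎)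
  where
  regroup : ∀ m c x y → m * c * (x * y) ≡ c * (x * (m * y))
  regroup = solve-∀

C-raise-lower : ∀ a b {m} → m ≡ suc (a + b) → suc a * (m C suc a) ≡ suc b * (m C a)
C-raise-lower a b refl = *-cancelʳ-≡ _ _ (a ! * b !) {{a !* b !≢0}} (begin
  suc a * (suc (a + b) C suc a) * (a ! * b !) ≡⟨ regroupˡ (suc a) (suc (a + b) C suc a) (a !) (b !) ⟩
  (suc (a + b) C suc a) * (suc a ! * b !)     ≡⟨ C-! (suc a) b ⟩
  suc (a + b) !                               ≡⟨ cong _! (+-suc a b) ⟨
  (a + suc b) !                               ≡⟨ C-! a (suc b) ⟨
  ((a + suc b) C a) * (a ! * suc b !)         ≡⟨ cong (λ m → (m C a) * (a ! * suc b !)) (+-suc a b) ⟩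
  (suc (a + b) C a) * (a ! * suc b !)         ≡⟨ regroupʳ (suc b) (suc (a + b) C a) (a !) (b !) ⟨
  suc b * (suc (a + b) C a) * (a ! * b !)     ∎)
  where
  regroupˡ : ∀ m c x y → m * c * (x * y) ≡ c * (m * x * y)
  regroupˡ = solve-∀
  regroupʳ : ∀ m c x y → m * c * (x * y) ≡ c * (x * (m * y))
  regroupʳ = solve-∀

-- Gosper telescoping over the natural numbers

weight : ℕ → ℕ
weight k = (2 * k + 2) * (2 * k + 3) * (2 * k + 4)

denominator : ℕ → ℕ
denominator n = (2 + 2 * n) * (3 + 2 * n) * (6 + 2 * n) * (7 + 2 * n)

-- Denominator of the certificate; clearing it keeps the telescoping in ℕ. With the constants first,
-- the product reduces to a successor, which supplies `NonZero` when it is cancelled at the end.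
gosperScale : ℕ → ℕ
gosperScale n = (2 + n) * (5 + 2 * n)

gosperPoly : ℕ → ℕ → ℕ
gosperPoly n k = 2 * ((n + 1) * (n + 3) + (2 * n + 5) * ((k + 1) * (k + 1)))

binomials : ℕ → ℕ → ℕ
binomials n j = ((2 * n + 3) C j) * ((2 * n + 7) C (j + 2))

-- For n = k + j this is gosperScale n times the sum of weight i * binomials n (n - i)
-- over k ≤ i ≤ n; j stands for n - k, which avoids truncated subtraction.
scaledTail : ℕ → ℕ → ℕ → ℕ
scaledTail n k j = gosperPoly n k * ((n + k + 3) * (n + k + 5)) * binomials n j

-- This is `gosper-step` continued to i = -1, where the factor i + 1 kills the term of the next
-- tail.
gosper-last : ∀ n → gosperScale n * weight n ≡ gosperPoly n n * ((n + n + 3) * (n + n + 5))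
gosper-last = identity
  where
  -- Definitionally the same statement, unfolded to show the ring solver a polynomial identity.
  identity : ∀ n → (2 + n) * (5 + 2 * n) * ((2 * n + 2) * (2 * n + 3) * (2 * n + 4)) ≡
    2 * ((n + 1) * (n + 3) + (2 * n + 5) * ((n + 1) * (n + 1))) * ((n + n + 3) * (n + n + 5))
  identity = solve-∀

-- Gosper's equation without its binomials: in the notation above, (i + 1)(i + 3) = (a - x)(b - x)
-- and (n + k + 3)(n + k + 5) = (a + x)(b + x). The change of x to -x swaps the two `gosperPoly`
-- terms, in keeping with the odd weight.
gosper-step : ∀ k i → let n = k + suc i in
  gosperScale n * weight k + gosperPoly n (suc k) * ((i + 1) * (i + 3)) ≡
  gosperPoly n k * ((n + k + 3) * (n + k + 5))
gosper-step = identity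
  where
  identity : ∀ k i →
    (2 + (k + (1 + i))) * (5 + 2 * (k + (1 + i))) * ((2 * k + 2) * (2 * k + 3) * (2 * k + 4)) +
    2 * ((k + (1 + i) + 1) * (k + (1 + i) + 3) + (2 * (k + (1 + i)) + 5) * ((1 + k + 1) * (1 + k + 1))) *
      ((i + 1) * (i + 3)) ≡
    2 * ((k + (1 + i) + 1) * (k + (1 + i) + 3) + (2 * (k + (1 + i)) + 5) * ((k + 1) * (k + 1))) *
      ((k + (1 + i) + k + 3) * (k + (1 + i) + k + 5))
  identity = solve-∀

-- The prefix on the left is the one in `scaledTail n (suc k) i`, so the tail from k + 1 becomes a
-- multiple of the binomials of term k. Each binomial takes one use of `C-raise-lower`.
binomials-step : ∀ k i → let n = k + suc i in
  (n + suc k + 3) * (n + suc k + 5) * binomials n i ≡ (i + 1) * (i + 3) * binomials n (suc i)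
binomials-step k i = begin
  (n + suc k + 3) * (n + suc k + 5) * (a * b)       ≡⟨ regroup₁ n k a b ⟩
  (suc (n + k + 3) * a) * (suc (n + k + 5) * b)     ≡⟨ cong₂ _*_
    (C-raise-lower i (n + k + 3) (index₁ k i)) (C-raise-lower (i + 2) (n + k + 5) (index₂ k i)) ⟨
  (suc i * a⁺) * (suc (i + 2) * b⁺)                 ≡⟨ regroup₂ i a⁺ b⁺ ⟩
  (i + 1) * (i + 3) * (a⁺ * b⁺)                     ∎
  where
  n = k + suc i
  a = (2 * n + 3) C i
  b = (2 * n + 7) C (i + 2)
  a⁺ = (2 * n + 3) C suc i
  b⁺ = (2 * n + 7) C suc (i + 2)
  index₁ : ∀ k i → 2 * (k + (1 + i)) + 3 ≡ 1 + (i + (k + (1 + i) + k + 3))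
  index₁ = solve-∀
  index₂ : ∀ k i → 2 * (k + (1 + i)) + 7 ≡ 1 + (i + 2 + (k + (1 + i) + k + 5))
  index₂ = solve-∀
  regroup₁ : ∀ n k a b →
    (n + (1 + k) + 3) * (n + (1 + k) + 5) * (a * b) ≡ ((1 + (n + k + 3)) * a) * ((1 + (n + k + 5)) * b)
  regroup₁ = solve-∀
  regroup₂ : ∀ i a b → ((1 + i) * a) * ((1 + (i + 2)) * b) ≡ (i + 1) * (i + 3) * (a * b)
  regroup₂ = solve-∀

scaledTail-last : ∀ n → gosperScale n * (weight n * binomials n 0) ≡ scaledTail n n 0
scaledTail-last n = trans (sym (*-assoc (gosperScale n) (weight n) (binomials n 0)))
  (cong (_* binomials n 0) (gosper-last n))

-- Term k plus the tail from k + 1 is the tail from k: once `binomials-step` has made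
-- `binomials n (suc i)` a common factor, only `gosper-step` remains.
scaledTail-step : ∀ k i → let n = k + suc i in
  gosperScale n * (weight k * binomials n (suc i)) + scaledTail n (suc k) i ≡ scaledTail n k (suc i)
scaledTail-step k i = begin
  s * (w * t⁺) + p⁺ * (u * v) * t                   ≡⟨ cong (λ m → s * (w * t⁺) + m) (*-assoc p⁺ (u * v) t) ⟩
  s * (w * t⁺) + p⁺ * (u * v * t)                   ≡⟨ cong (λ m → s * (w * t⁺) + p⁺ * m) (binomials-step k i) ⟩
  s * (w * t⁺) + p⁺ * ((i + 1) * (i + 3) * t⁺)      ≡⟨ regroup s w p⁺ ((i + 1) * (i + 3)) t⁺ ⟩
  (s * w + p⁺ * ((i + 1) * (i + 3))) * t⁺           ≡⟨ cong (_* t⁺) (gosper-step k i) ⟩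
  scaledTail n k (suc i)                               ∎
  where
  n = k + suc i
  s = gosperScale n
  w = weight k
  p⁺ = gosperPoly n (suc k)
  u = n + suc k + 3
  v = n + suc k + 5
  t = binomials n i
  t⁺ = binomials n (suc i)
  regroup : ∀ s w p q t → s * (w * t) + p * (q * t) ≡ (s * w + p * q) * t
  regroup = solve-∀

-- From the telescoping to the rational sum

denominator-*-summand : ∀ n k →
  fromℕ (denominator n) ℚ.* summand n k ≡ fromℕ (weight k * binomials n (n ∸ k))
denominator-*-summand n k = begin
  d ℚ.* (r ℚ.* fromℕ a ℚ.* fromℕ b)              ≡⟨ cong (d ℚ.*_) (ℚ.*-assoc r (fromℕ a) (fromℕ b)) ⟩
  d ℚ.* (r ℚ.* (fromℕ a ℚ.* fromℕ b))            ≡⟨ ℚ.*-assoc d r _ ⟨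
  d ℚ.* r ℚ.* (fromℕ a ℚ.* fromℕ b)              ≡⟨ cong₂ ℚ._*_ (fromℕ-*-/ (denominator n) (weight k)) (sym (fromℕ-* a b)) ⟩
  fromℕ (weight k) ℚ.* fromℕ (a * b)             ≡⟨ fromℕ-* (weight k) (a * b) ⟨
  fromℕ (weight k * (a * b))                     ∎
  where
  d = fromℕ (denominator n)
  r = + weight k ℚ./ denominator n
  a = (2 * n + 3) C (n ∸ k)
  b = (2 * n + 7) C (n ∸ k + 2)

scale-*-summand : ∀ n k j → n ≡ k + j →
  fromℕ (gosperScale n * denominator n) ℚ.* summand n k ≡
  fromℕ (gosperScale n * (weight k * binomials n j))
scale-*-summand n k j n≡k+j = begin
  fromℕ (s * d) ℚ.* summand n k            ≡⟨ cong (ℚ._* summand n k) (fromℕ-* s d) ⟩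
  fromℕ s ℚ.* fromℕ d ℚ.* summand n k      ≡⟨ ℚ.*-assoc (fromℕ s) (fromℕ d) (summand n k) ⟩
  fromℕ s ℚ.* (fromℕ d ℚ.* summand n k)    ≡⟨ cong (fromℕ s ℚ.*_) (denominator-*-summand n k) ⟩
  fromℕ s ℚ.* fromℕ (weight k * binomials n (n ∸ k)) ≡⟨ fromℕ-* s (weight k * binomials n (n ∸ k)) ⟨
  fromℕ (s * (weight k * binomials n (n ∸ k))) ≡⟨ cong (λ i → fromℕ (s * (weight k * binomials n i))) n∸k≡j ⟩
  fromℕ (s * (weight k * binomials n j))   ∎
  where
  s = gosperScale n
  d = denominator n
  n∸k≡j : n ∸ k ≡ j
  n∸k≡j = trans (cong (_∸ k) n≡k+j) (m+n∸m≡n k j)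

-- Induction on j with n fixed: the sum sheds its first term, so the claim is generalised to tails
-- starting at any k. The whole sum is k = 0.
scale-*-sum : ∀ j {n} k → n ≡ k + j →
  fromℕ (gosperScale n * denominator n) ℚ.* (∑[ i ≤ j ] summand n (k + toℕ i)) ≡
  fromℕ (scaledTail n k j)
scale-*-sum zero {n} k n≡k+0 = begin
  e ℚ.* (summand n (k + 0) ℚ.+ ℚ.0ℚ)     ≡⟨ cong (e ℚ.*_) (ℚ.+-identityʳ (summand n (k + 0))) ⟩
  e ℚ.* summand n (k + 0)                ≡⟨ cong (λ m → e ℚ.* summand n m) (+-identityʳ k) ⟩
  e ℚ.* summand n k                      ≡⟨ scale-*-summand n k 0 n≡k+0 ⟩
  fromℕ (gosperScale n * (weight k * binomials n 0)) ≡⟨ cong fromℕ (last k (trans n≡k+0 (+-identityʳ k))) ⟩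
  fromℕ (scaledTail n k 0)                  ∎
  where
  e = fromℕ (gosperScale n * denominator n)
  last : ∀ k → n ≡ k → gosperScale n * (weight k * binomials n 0) ≡ scaledTail n k 0
  last _ refl = scaledTail-last n
scale-*-sum (suc j) {n} k n≡k+1+j = begin
  e ℚ.* (summand n (k + 0) ℚ.+ (∑[ i ≤ j ] summand n (k + suc (toℕ i))))
    ≡⟨ cong (e ℚ.*_) (cong₂ ℚ._+_ (cong (summand n) (+-identityʳ k))
         (sum-cong-≗ (λ (i : Fin (suc j)) → cong (summand n) (+-suc k (toℕ i))))) ⟩
  e ℚ.* (summand n k ℚ.+ (∑[ i ≤ j ] summand n (suc k + toℕ i)))
    ≡⟨ ℚ.*-distribˡ-+ e _ _ ⟩
  e ℚ.* summand n k ℚ.+ e ℚ.* (∑[ i ≤ j ] summand n (suc k + toℕ i))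
    ≡⟨ cong₂ ℚ._+_ (scale-*-summand n k (suc j) n≡k+1+j)
         (scale-*-sum j (suc k) (trans n≡k+1+j (+-suc k j))) ⟩
  fromℕ (gosperScale n * (weight k * binomials n (suc j))) ℚ.+ fromℕ (scaledTail n (suc k) j)
    ≡⟨ fromℕ-+ (gosperScale n * (weight k * binomials n (suc j))) (scaledTail n (suc k) j) ⟨
  fromℕ (gosperScale n * (weight k * binomials n (suc j)) + scaledTail n (suc k) j)
    ≡⟨ cong fromℕ (step n≡k+1+j) ⟩
  fromℕ (scaledTail n k (suc j)) ∎
  where
  e = fromℕ (gosperScale n * denominator n)
  step : ∀ {n} → n ≡ k + suc j →
    gosperScale n * (weight k * binomials n (suc j)) + scaledTail n (suc k) j ≡ scaledTail n k (suc j)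
  step refl = scaledTail-step k j

-- Closed form through central binomials

suc-*-catalan : ∀ m → fromℕ (suc m) ℚ.* catalan m ≡ fromℕ ((2 * m) C m)
suc-*-catalan m = begin
  fromℕ (suc m) ℚ.* (+ 1 ℚ./ suc m ℚ.* c)  ≡⟨ ℚ.*-assoc (fromℕ (suc m)) (+ 1 ℚ./ suc m) c ⟨
  fromℕ (suc m) ℚ.* (+ 1 ℚ./ suc m) ℚ.* c  ≡⟨ cong (ℚ._* c) (fromℕ-*-/ (suc m) 1) ⟩
  ℚ.1ℚ ℚ.* c                               ≡⟨ ℚ.*-identityˡ c ⟩
  c                                        ∎
  where c = fromℕ ((2 * m) C m)

-- The path is C(2n+3, n) to C(2n+2, n) to C(2n+2, n+1): one step in the upper index, then one in
-- the lower.
[2n+3]Cn-central : ∀ n →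
  (n + 3) * (n + 2) * ((2 * n + 3) C n) ≡ (2 * n + 3) * (n + 1) * ((2 * (n + 1)) C (n + 1))
[2n+3]Cn-central n = begin
  (n + 3) * (n + 2) * x                ≡⟨ regroup₁ n x ⟩
  (n + 2) * (suc (n + 2) * x)          ≡⟨ cong ((n + 2) *_) (C-raise-upper n (n + 2) (index₁ n) (index₂ n)) ⟩
  (n + 2) * ((2 * n + 3) * y)          ≡⟨ regroup₂ n y ⟩
  (2 * n + 3) * (suc (n + 1) * y)      ≡⟨ cong ((2 * n + 3) *_) (C-raise-lower n (n + 1) (index₃ n)) ⟨
  (2 * n + 3) * (suc n * z)            ≡⟨ cong (λ m → (2 * n + 3) * (m * ((2 * (n + 1)) C m))) (+-comm 1 n) ⟩
  (2 * n + 3) * ((n + 1) * z′)         ≡⟨ *-assoc (2 * n + 3) (n + 1) z′ ⟨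
  (2 * n + 3) * (n + 1) * z′           ∎
  where
  x = (2 * n + 3) C n
  y = (2 * (n + 1)) C n
  z = (2 * (n + 1)) C suc n
  z′ = (2 * (n + 1)) C (n + 1)
  index₁ : ∀ n → 2 * n + 3 ≡ 1 + 2 * (n + 1)
  index₁ = solve-∀
  index₂ : ∀ n → 2 * (n + 1) ≡ n + (n + 2)
  index₂ = solve-∀
  index₃ : ∀ n → 2 * (n + 1) ≡ 1 + (n + (n + 1))
  index₃ = solve-∀
  regroup₁ : ∀ n x → (n + 3) * (n + 2) * x ≡ (n + 2) * ((1 + (n + 2)) * x)
  regroup₁ = solve-∀
  regroup₂ : ∀ n y → (n + 2) * ((2 * n + 3) * y) ≡ (2 * n + 3) * ((1 + (n + 1)) * y)
  regroup₂ = solve-∀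

-- The lower index is already central for 2n + 4, so three steps in the upper index suffice.
[2n+7]C[n+2]-central : ∀ n →
  (n + 5) * (n + 4) * (n + 3) * ((2 * n + 7) C (n + 2)) ≡
  (2 * n + 7) * (2 * n + 6) * (2 * n + 5) * ((2 * (n + 2)) C (n + 2))
[2n+7]C[n+2]-central n = begin
  (n + 5) * (n + 4) * (n + 3) * x₇               ≡⟨ regroup₁ n x₇ ⟩
  (n + 3) * (n + 4) * (suc (n + 4) * x₇)         ≡⟨ cong (((n + 3) * (n + 4)) *_) (C-raise-upper (n + 2) (n + 4) (index₁ n) (index₂ n)) ⟩
  (n + 3) * (n + 4) * ((2 * n + 7) * x₆)         ≡⟨ regroup₂ n x₆ ⟩
  (n + 3) * (2 * n + 7) * (suc (n + 3) * x₆)     ≡⟨ cong (((n + 3) * (2 * n + 7)) *_) (C-raise-upper (n + 2) (n + 3) (index₃ n) (index₄ n)) ⟩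
  (n + 3) * (2 * n + 7) * ((2 * n + 6) * x₅)     ≡⟨ regroup₃ n x₅ ⟩
  (2 * n + 7) * (2 * n + 6) * (suc (n + 2) * x₅) ≡⟨ cong (((2 * n + 7) * (2 * n + 6)) *_) (C-raise-upper (n + 2) (n + 2) (index₅ n) (index₆ n)) ⟩
  (2 * n + 7) * (2 * n + 6) * ((2 * n + 5) * x₄) ≡⟨ *-assoc ((2 * n + 7) * (2 * n + 6)) (2 * n + 5) x₄ ⟨
  (2 * n + 7) * (2 * n + 6) * (2 * n + 5) * x₄   ∎
  where
  x₇ = (2 * n + 7) C (n + 2)
  x₆ = (2 * n + 6) C (n + 2)
  x₅ = (2 * n + 5) C (n + 2)
  x₄ = (2 * (n + 2)) C (n + 2)
  index₁ : ∀ n → 2 * n + 7 ≡ 1 + (2 * n + 6)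
  index₁ = solve-∀
  index₂ : ∀ n → 2 * n + 6 ≡ n + 2 + (n + 4)
  index₂ = solve-∀
  index₃ : ∀ n → 2 * n + 6 ≡ 1 + (2 * n + 5)
  index₃ = solve-∀
  index₄ : ∀ n → 2 * n + 5 ≡ n + 2 + (n + 3)
  index₄ = solve-∀
  index₅ : ∀ n → 2 * n + 5 ≡ 1 + (2 * (n + 2))
  index₅ = solve-∀
  index₆ : ∀ n → 2 * (n + 2) ≡ n + 2 + (n + 2)
  index₆ = solve-∀
  regroup₁ : ∀ n x → (n + 5) * (n + 4) * (n + 3) * x ≡ (n + 3) * (n + 4) * ((1 + (n + 4)) * x)
  regroup₁ = solve-∀
  regroup₂ : ∀ n x → (n + 3) * (n + 4) * ((2 * n + 7) * x) ≡ (n + 3) * (2 * n + 7) * ((1 + (n + 3)) * x)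
  regroup₂ = solve-∀
  regroup₃ : ∀ n x →
    (n + 3) * (2 * n + 7) * ((2 * n + 6) * x) ≡ (2 * n + 7) * (2 * n + 6) * ((1 + (n + 2)) * x)
  regroup₃ = solve-∀

scaledTail-zero : ∀ n →
  suc (n + 1) * suc (n + 2) * scaledTail n 0 n ≡
  gosperScale n * denominator n * (((2 * (n + 1)) C (n + 1)) * ((2 * (n + 2)) C (n + 2)))
scaledTail-zero n = begin
  suc (n + 1) * suc (n + 2) * scaledTail n 0 n
    -- At k = 0 the certificate factors: (n + 1)(n + 3) + (2n + 5) = (n + 2)(n + 4). With the
    -- Catalan denominators n + 2 and n + 3 this gives exactly the prefactors of the two central
    -- reductions, up to 2(n + 2).
    ≡⟨ regroup₁ n x y ⟩
  2 * (n + 2) * (((n + 3) * (n + 2) * x) * ((n + 5) * (n + 4) * (n + 3) * y))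
    ≡⟨ cong ((2 * (n + 2)) *_) (cong₂ _*_ ([2n+3]Cn-central n) ([2n+7]C[n+2]-central n)) ⟩
  2 * (n + 2) * (((2 * n + 3) * (n + 1) * c) * ((2 * n + 7) * (2 * n + 6) * (2 * n + 5) * d))
    ≡⟨ regroup₂ n c d ⟩
  gosperScale n * denominator n * (c * d) ∎
  where
  x = (2 * n + 3) C n
  y = (2 * n + 7) C (n + 2)
  c = (2 * (n + 1)) C (n + 1)
  d = (2 * (n + 2)) C (n + 2)
  regroup₁ : ∀ n x y →
    (1 + (n + 1)) * (1 + (n + 2)) *
      (2 * ((n + 1) * (n + 3) + (2 * n + 5) * ((0 + 1) * (0 + 1))) * ((n + 0 + 3) * (n + 0 + 5)) * (x * y)) ≡
    2 * (n + 2) * (((n + 3) * (n + 2) * x) * ((n + 5) * (n + 4) * (n + 3) * y))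
  regroup₁ = solve-∀
  regroup₂ : ∀ n c d →
    2 * (n + 2) * (((2 * n + 3) * (n + 1) * c) * ((2 * n + 7) * (2 * n + 6) * (2 * n + 5) * d)) ≡
    (2 + n) * (5 + 2 * n) * ((2 + 2 * n) * (3 + 2 * n) * (6 + 2 * n) * (7 + 2 * n)) * (c * d)
  regroup₂ = solve-∀

corollary3p12 : (n : ℕ) →
    catalan (n + 1) ℚ.* catalan (n + 2) ≡ ∑[ k ≤ n ] summand n (toℕ k)
-- Two positive factors clear all denominators: the first those of the summands and the certificate,
-- `a * b` those of the Catalan numbers. What is left is the identity `scaledTail-zero` in ℕ.
corollary3p12 n = fromℕ-*-cancelˡ (gosperScale n * denominator n) (fromℕ-*-cancelˡ (a * b) (begin
  fromℕ (a * b) ℚ.* (e ℚ.* (catalan (n + 1) ℚ.* catalan (n + 2)))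
    ≡⟨ x∙yz≈y∙xz (fromℕ (a * b)) e _ ⟩
  e ℚ.* (fromℕ (a * b) ℚ.* (catalan (n + 1) ℚ.* catalan (n + 2)))
    ≡⟨ cong (e ℚ.*_) catalans ⟩
  e ℚ.* fromℕ (c * d)
    ≡⟨ fromℕ-* (gosperScale n * denominator n) (c * d) ⟨
  fromℕ (gosperScale n * denominator n * (c * d))
    ≡⟨ cong fromℕ (scaledTail-zero n) ⟨
  fromℕ (a * b * scaledTail n 0 n)
    ≡⟨ fromℕ-* (a * b) (scaledTail n 0 n) ⟩
  fromℕ (a * b) ℚ.* fromℕ (scaledTail n 0 n)
    ≡⟨ cong (fromℕ (a * b) ℚ.*_) (scale-*-sum n 0 refl) ⟨
  fromℕ (a * b) ℚ.* (e ℚ.* (∑[ k ≤ n ] summand n (toℕ k))) ∎))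
  where
  a = suc (n + 1)
  b = suc (n + 2)
  c = (2 * (n + 1)) C (n + 1)
  d = (2 * (n + 2)) C (n + 2)
  e = fromℕ (gosperScale n * denominator n)
  catalans : fromℕ (a * b) ℚ.* (catalan (n + 1) ℚ.* catalan (n + 2)) ≡ fromℕ (c * d)
  catalans = begin
    fromℕ (a * b) ℚ.* (catalan (n + 1) ℚ.* catalan (n + 2))
      ≡⟨ cong (ℚ._* (catalan (n + 1) ℚ.* catalan (n + 2))) (fromℕ-* a b) ⟩
    fromℕ a ℚ.* fromℕ b ℚ.* (catalan (n + 1) ℚ.* catalan (n + 2))
      ≡⟨ interchange (fromℕ a) (fromℕ b) (catalan (n + 1)) (catalan (n + 2)) ⟩
    (fromℕ a ℚ.* catalan (n + 1)) ℚ.* (fromℕ b ℚ.* catalan (n + 2))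
      ≡⟨ cong₂ ℚ._*_ (suc-*-catalan (n + 1)) (suc-*-catalan (n + 2)) ⟩
    fromℕ c ℚ.* fromℕ d
      ≡⟨ fromℕ-* c d ⟨
    fromℕ (c * d) ∎
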